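{- There exists a sorting network on $20$ channels with $11$ layers, and consequently there exists a sorting network on $19$ channels with at most $11$ layers; that is, $t_{20}\le 11$ and $t_{19}\le 11$, where $t_n$ denotes the minimum depth of a sorting network on $n$ channels.
   Context: A comparator network on $n$ channels is a finite sequence $C=L_1,\ldots,L_d$ of layers, where each layer is a non-empty set of pairs (comparators) $(i,j)$ with $1\le i<j\le n$, and any two distinct comparators in the same layer are disjoint as sets of channels. Its depth (number of layers) is $d$. The network acts on a sequence $(x_1,\ldots,x_n)$ of elements of a totally ordered set by applying the layers in order: applying a layer interchanges the values on channels $i$ and $j$ for every comparator $(i,j)$ of the layer such that the current value on channel $i$ is larger than the one on channel $j$. The network is a sorting network if its output is sorted in non-decreasing order ($x_1\le\cdots\le x_n$) for every input; by the zero-one principle, it is equivalent to require this for all inputs in $\{0,1\}^n$. -}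

module Defs where

open import Data.Bool.Base using (if_then_else_)
open import Data.Fin.Base as Fin using (Fin)
open import Data.Fin.Permutation.Components using (transpose)
open import Data.List.Base using (List; []; _∷_; length; foldl)
open import Data.List.NonEmpty.Base as List⁺ using (List⁺)
open import Data.List.Relation.Binary.Disjoint.Propositional using (Disjoint)
open import Data.List.Relation.Unary.AllPairs using (AllPairs)
open import Data.Nat.Base using (ℕ; _≤_)
open import Data.Product.Base using (_×_; ∃-syntax)
open import Data.Vec.Functional using (Vector)
open import Function.Base using (_∘_)
open import Level using (Level; suc; _⊔_)
open import Relation.Binary.Bundles using (DecTotalOrder)
open import Relation.Binary.Definitions using (Monotonic₁)
open import Relation.Binary.PropositionalEquality.Core using (_≡_)
open import Relation.Nullary.Decidable.Core using (does)

record Comparator (n : ℕ) : Set where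
  constructor comparator
  field
    lo    : Fin n
    hi    : Fin n
    lo<hi : lo Fin.< hi

  channels : List (Fin n)
  channels = lo ∷ hi ∷ []

-- A finite non-empty set of comparators is given by a listing of it; pairwise
-- disjointness already forces the listed comparators to be distinct.
record Layer (n : ℕ) : Set where
  constructor layer
  field
    comparators : List⁺ (Comparator n)
    disjoint    : AllPairs (λ c c′ → Disjoint (Comparator.channels c) (Comparator.channels c′))
                           (List⁺.toList comparators)

Network : ℕ → Set
Network n = List (Layer n)

depth : ∀ {n} → Network n → ℕ
depth = length

-- Decidability of the order is what lets a comparator constructively act on
-- two values; classically every total order is decidable.
module _ {c ℓ₁ ℓ₂ : Level} (O : DecTotalOrder c ℓ₁ ℓ₂) where
  open DecTotalOrder O using (Carrier; _≤?_)

  applyComparator : ∀ {n} → Vector Carrier n → Comparator n → Vector Carrier n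
  applyComparator x (comparator i j _) =
    if does (x i ≤? x j) then x else x ∘ transpose i j

  -- The comparators of a layer touch disjoint channels, so applying them one
  -- after the other, in any order, is the same as applying them simultaneously.
  applyLayer : ∀ {n} → Vector Carrier n → Layer n → Vector Carrier n
  applyLayer x L = foldl applyComparator x (List⁺.toList (Layer.comparators L))

  applyNetwork : ∀ {n} → Network n → Vector Carrier n → Vector Carrier n
  applyNetwork C x = foldl applyLayer x C

-- The level arguments only fix the universes of the ordered sets considered.
IsSortingNetwork : ∀ c ℓ₁ ℓ₂ {n} → Network n → Set (suc (c ⊔ ℓ₁ ⊔ ℓ₂))
IsSortingNetwork c ℓ₁ ℓ₂ {n} C =
  (O : DecTotalOrder c ℓ₁ ℓ₂) (x : Vector (DecTotalOrder.Carrier O) n) →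
  Monotonic₁ Fin._≤_ (DecTotalOrder._≤_ O) (applyNetwork O C x)

-- "t is the minimum depth of a sorting network on n channels", i.e. t = t_n.
IsMinimumDepth : ∀ c ℓ₁ ℓ₂ → ℕ → ℕ → Set (suc (c ⊔ ℓ₁ ⊔ ℓ₂))
IsMinimumDepth c ℓ₁ ℓ₂ n t =
  (∃[ C ] IsSortingNetwork c ℓ₁ ℓ₂ {n} C × depth C ≡ t) ×
  (∀ (C : Network n) → IsSortingNetwork c ℓ₁ ℓ₂ C → t ≤ depth C)

{-# OPTIONS --safe #-}
-- By the zero-one principle it suffices to sort bit vectors.  The first three
-- layers of the 20-channel network act separately on two blocks of eight
-- channels and one block of four, and leave only 20, 20 and 6 possible values on
-- them; the remaining eight layers are run on these 2400 vectors.  On 19 channels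
-- one deletes channel 0 of the 20-channel network: a bit 0 fed to it never moves.
module Submission where

open import Defs
open import Data.Bool.Base as Bool using (Bool; true; false; _∧_; _∨_; b≤b; f≤t)
import Data.Bool.Properties as Bool
open import Data.Fin.Base as Fin using (Fin; zero; suc)
open import Data.Fin.Permutation.Components using (transpose)
import Data.Fin.Properties as Fin
open import Data.List.Base as List using (List; []; _∷_; foldl; mapMaybe; concatMap)
open import Data.List.Membership.Propositional using (_∈_)
open import Data.List.Membership.Propositional.Properties
  using (∈-map⁺; ∈-++⁺ˡ; ∈-++⁺ʳ; ∈-deduplicate⁺)
open import Data.List.NonEmpty.Base as List⁺ using (List⁺; _∷_)
open import Data.List.Properties using (concatMap-++; foldl-++; mapMaybe-++; length-mapMaybe)
import Data.List.Relation.Binary.Disjoint.DecPropositional as Disjoint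
open import Data.List.Relation.Binary.Disjoint.Propositional using (Disjoint)
open import Data.List.Relation.Unary.All as All using (All; []; _∷_)
open import Data.List.Relation.Unary.AllPairs using (AllPairs; []; _∷_; allPairs?)
open import Data.List.Relation.Unary.Any using (here)
open import Data.Maybe.Base using (Maybe; just; nothing; maybe)
open import Data.Nat.Base using (ℕ; zero; suc; _≤_; s<s⁻¹)
import Data.Nat.Properties as ℕ
open import Data.Product.Base using (_×_; ∃-syntax; _,_; proj₁; proj₂)
open import Data.Sum.Base using (inj₁; inj₂)
open import Data.Vec.Base as Vec using (Vec; []; _∷_; lookup; tabulate; _[_]≔_)
import Data.Vec.Properties as Vec
open import Data.Vec.Functional using (Vector)
open import Data.Vec.Relation.Unary.Linked as Linked using (Linked; linked?)
import Data.Vec.Relation.Unary.Linked.Properties as Linked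
open import Function.Base using (_∘_)
open import Level using (Level)
open import Relation.Binary.Bundles using (DecTotalOrder)
open import Relation.Binary.PropositionalEquality.Core
  using (_≡_; _≢_; _≗_; refl; sym; trans; cong; cong₂; subst; subst₂)
open import Relation.Nullary using (Dec; yes; no; does; contradiction)
open import Relation.Nullary.Decidable using (True; toWitness; dec-true; dec-false)

private variable
  n : ℕ

-- Networks as flat lists of comparators.

comparatorsOf : Layer n → List (Comparator n)
comparatorsOf = List⁺.toList ∘ Layer.comparators

flatten : Network n → List (Comparator n)
flatten = concatMap comparatorsOf

-- Sorting of bit vectors

-- On bits, `∧` is the minimum and `∨` the maximum. This branch-free form keeps computing when the
-- bits are variables, so `runBits-interleave` can hold by `refl`.
sortBits₂ : Vec Bool n → Comparator n → Vec Bool n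
sortBits₂ v (comparator i j _) =
  v [ i ]≔ (lookup v i ∧ lookup v j) [ j ]≔ (lookup v i ∨ lookup v j)

runBits : List (Comparator n) → Vec Bool n → Vec Bool n
runBits cs v = foldl sortBits₂ v cs

SortsBits : List (Comparator n) → Set
SortsBits cs = ∀ v → Linked Bool._≤_ (runBits cs v)

runBits-flatten-++ : ∀ (C D : Network n) v →
  runBits (flatten (C List.++ D)) v ≡ runBits (flatten D) (runBits (flatten C) v)
runBits-flatten-++ C D v = trans
  (cong (λ cs → runBits cs v) (concatMap-++ comparatorsOf C D))
  (foldl-++ sortBits₂ v (flatten C) (flatten D))

≤⇒∧≡ˡ : ∀ {a b} → a Bool.≤ b → a ∧ b ≡ a
≤⇒∧≡ˡ f≤t       = refl
≤⇒∧≡ˡ (b≤b {b}) = Bool.∧-idem b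

≤⇒∨≡ʳ : ∀ {a b} → a Bool.≤ b → a ∨ b ≡ b
≤⇒∨≡ʳ f≤t       = refl
≤⇒∨≡ʳ (b≤b {b}) = Bool.∨-idem b

-- The target `f` is left arbitrary so that one lemma serves both outcomes of a comparator, exchange
-- and no exchange. Position `j` is tested first because its update is the outer one.
lookup-sortBits₂ : ∀ (v : Vec Bool n) i j i<j (f : Fin n → Bool) →
  f i ≡ lookup v i ∧ lookup v j → f j ≡ lookup v i ∨ lookup v j →
  (∀ k → k ≢ i → k ≢ j → f k ≡ lookup v k) →
  lookup (sortBits₂ v (comparator i j i<j)) ≗ f
lookup-sortBits₂ v i j i<j f fi fj fk k with k Fin.≟ j
... | yes refl = trans (Vec.lookup∘update j (v [ i ]≔ _) _) (sym fj)
... | no k≢j with k Fin.≟ i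
...   | yes refl = trans (Vec.lookup∘update′ k≢j (v [ i ]≔ _) _)
                    (trans (Vec.lookup∘update i v _) (sym fi))
...   | no k≢i   = trans (Vec.lookup∘update′ k≢j (v [ i ]≔ _) _)
                    (trans (Vec.lookup∘update′ k≢i v _) (sym (fk k k≢i k≢j)))

transpose-fst : ∀ (i j : Fin n) → transpose i j i ≡ j
transpose-fst i j rewrite dec-true (i Fin.≟ i) refl = refl

transpose-snd : ∀ (i j : Fin n) → transpose i j j ≡ i
transpose-snd i j with j Fin.≟ i
... | yes j≡i = j≡i
... | no  _ rewrite dec-true (j Fin.≟ j) refl = refl

transpose-other : ∀ (i j : Fin n) k → k ≢ i → k ≢ j → transpose i j k ≡ k
transpose-other i j k k≢i k≢j
  rewrite dec-false (k Fin.≟ i) k≢i | dec-false (k Fin.≟ j) k≢j = refl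

-- The zero-one principle

module _ {c ℓ₁ ℓ₂ : Level} (O : DecTotalOrder c ℓ₁ ℓ₂) where
  private module O = DecTotalOrder O
  open O using (Carrier; _≤?_)

  applyNetwork-flatten : ∀ (C : Network n) x →
    applyNetwork O C x ≡ foldl (applyComparator O) x (flatten C)
  applyNetwork-flatten []      x = refl
  applyNetwork-flatten (L ∷ C) x = trans (applyNetwork-flatten C _)
    (sym (foldl-++ (applyComparator O) x (comparatorsOf L) (flatten C)))

  module _ (t : Carrier → Bool) (t-mono : ∀ {a b} → a O.≤ b → t a Bool.≤ t b) where

    -- A monotone `t` carries minimum to `∧` and maximum to `∨`. When the values are exchanged,
    -- totality gives the reverse inequality, and commutativity reduces this case to the same two
    -- laws.
    sortBits₂-natural : ∀ (v : Vec Bool n) (x : Vector Carrier n) → lookup v ≗ t ∘ x →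
      ∀ γ → lookup (sortBits₂ v γ) ≗ t ∘ applyComparator O x γ
    sortBits₂-natural v x v≗tx (comparator i j i<j) with x i ≤? x j
    ... | yes xi≤xj = lookup-sortBits₂ v i j i<j (t ∘ x)
            (sym (trans (cong₂ _∧_ (v≗tx i) (v≗tx j)) (≤⇒∧≡ˡ (t-mono xi≤xj))))
            (sym (trans (cong₂ _∨_ (v≗tx i) (v≗tx j)) (≤⇒∨≡ʳ (t-mono xi≤xj))))
            (λ k _ _ → sym (v≗tx k))
    ... | no xi≰xj = lookup-sortBits₂ v i j i<j (t ∘ x ∘ transpose i j)
            (trans (cong (t ∘ x) (transpose-fst i j)) (sym
              (trans (cong₂ _∧_ (v≗tx i) (v≗tx j))
                (trans (Bool.∧-comm (t (x i)) _) (≤⇒∧≡ˡ txj≤txi)))))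
            (trans (cong (t ∘ x) (transpose-snd i j)) (sym
              (trans (cong₂ _∨_ (v≗tx i) (v≗tx j))
                (trans (Bool.∨-comm (t (x i)) _) (≤⇒∨≡ʳ txj≤txi)))))
            (λ k k≢i k≢j → trans (cong (t ∘ x) (transpose-other i j k k≢i k≢j)) (sym (v≗tx k)))
      where
      txj≤txi : t (x j) Bool.≤ t (x i)
      txj≤txi with O.total (x i) (x j)
      ... | inj₁ xi≤xj = contradiction xi≤xj xi≰xj
      ... | inj₂ xj≤xi = t-mono xj≤xi

    runBits-natural : ∀ cs (v : Vec Bool n) (x : Vector Carrier n) → lookup v ≗ t ∘ x →
      lookup (runBits cs v) ≗ t ∘ foldl (applyComparator O) x cs
    runBits-natural []       v x v≗tx = v≗tx
    runBits-natural (γ ∷ cs) v x v≗tx =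
      runBits-natural cs _ _ (sortBits₂-natural v x v≗tx γ)

  -- If outputs i ≤ j were out of order, the indicator of the values above
  -- output i would turn the input into bits that are not sorted either.
  zero-one : ∀ (C : Network n) → SortsBits (flatten C) → ∀ x {i j} → i Fin.≤ j →
             applyNetwork O C x i O.≤ applyNetwork O C x j
  zero-one {n} C sorts x {i} {j} i≤j
    with (applyNetwork O C x i ≤? applyNetwork O C x j) | ℕ.m≤n⇒m<n∨m≡n i≤j
  ... | yes yi≤yj | _          = yi≤yj
  -- `Linked.lookup⁺` compares only strictly increasing positions, so equal positions are settled by
  -- reflexivity.
  ... | no  yi≰yj | inj₂ i≡j   = contradiction
          (O.reflexive (O.Eq.reflexive (cong (applyNetwork O C x) (Fin.toℕ-injective i≡j)))) yi≰yj
  ... | no  yi≰yj | inj₁ i<j   = contradiction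
          (subst₂ Bool._≤_ (trans (bits i) (dec-true (y i ≤? y i) O.refl))
                           (trans (bits j) (dec-false (y i ≤? y j) yi≰yj))
            (Linked.lookup⁺ Bool.≤-trans (sorts input) i<j))
          λ ()
    where
    y : Vector Carrier n
    y = applyNetwork O C x

    -- The threshold is inclusive: output `i` becomes `true` by reflexivity, output `j` becomes
    -- `false` by `yi≰yj`, and `true ≤ false` is empty.
    t : Carrier → Bool
    t a = does (y i ≤? a)

    t-mono : ∀ {a b} → a O.≤ b → t a Bool.≤ t b
    t-mono {a} {b} a≤b with y i ≤? a
    ... | no  _    = Bool.≤-minimum _
    ... | yes yi≤a = Bool.≤-reflexive (sym (dec-true (y i ≤? b) (O.trans yi≤a a≤b)))

    input : Vec Bool n
    input = tabulate (t ∘ x)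

    bits : lookup (runBits (flatten C) input) ≗ t ∘ y
    bits k = trans
      (runBits-natural t t-mono (flatten C) input x (Vec.lookup∘tabulate (t ∘ x)) k)
      (cong (λ z → t (z k)) (sym (applyNetwork-flatten C x)))

-- Deleting channel 0

-- Since `lo < hi`, channel 0 can occur only as `lo`; the first clause therefore catches every
-- comparator that touches it.
deleteComparator : Comparator (suc n) → Maybe (Comparator n)
deleteComparator (comparator zero    _       _)   = nothing
deleteComparator (comparator (suc i) (suc j) i<j) = just (comparator i j (s<s⁻¹ i<j))

deleteComparator-channels : ∀ (γ : Comparator (suc n)) {γ′} → deleteComparator γ ≡ just γ′ →
  Comparator.channels γ ≡ List.map suc (Comparator.channels γ′)
deleteComparator-channels (comparator (suc i) (suc j) i<j) refl = refl

mapMaybe-allPairs : ∀ {a b r s} {A : Set a} {B : Set b} {R : A → A → Set r} {S : B → B → Set s}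
  (f : A → Maybe B) → (∀ {x y x′ y′} → f x ≡ just x′ → f y ≡ just y′ → R x y → S x′ y′) →
  ∀ {xs} → AllPairs R xs → AllPairs S (mapMaybe f xs)
mapMaybe-allPairs f R⇒S [] = []
mapMaybe-allPairs {R = R} {S} f R⇒S {x ∷ xs} (rx ∷ rxs) with f x in fx
... | nothing = mapMaybe-allPairs f R⇒S rxs
... | just x′ = related rx ∷ mapMaybe-allPairs f R⇒S rxs
  where
  related : ∀ {ys} → All (R x) ys → All (S x′) (mapMaybe f ys)
  related []                 = []
  related (_∷_ {x = y} ry rys) with f y in fy
  ... | nothing = related rys
  ... | just y′ = R⇒S fx fy ry ∷ related rys

ComparatorsDisjoint : Comparator n → Comparator n → Set
ComparatorsDisjoint γ δ = Disjoint (Comparator.channels γ) (Comparator.channels δ)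

-- Layers must be non-empty, so a layer that loses its only comparator disappears. Deletion thus
-- yields an upper bound on the depth rather than an equality.
layer? : (cs : List (Comparator n)) → AllPairs ComparatorsDisjoint cs → Maybe (Layer n)
layer? []       _ = nothing
layer? (c ∷ cs) d = just (layer (c ∷ cs) d)

deleteComparator-disjoint : ∀ {γ δ : Comparator (suc n)} {γ′ δ′} →
  deleteComparator γ ≡ just γ′ → deleteComparator δ ≡ just δ′ →
  ComparatorsDisjoint γ δ → ComparatorsDisjoint γ′ δ′
deleteComparator-disjoint {γ = γ} {δ} eγ eδ dis {v} (v∈γ′ , v∈δ′) = dis
  ( subst (suc v ∈_) (sym (deleteComparator-channels γ eγ)) (∈-map⁺ suc v∈γ′)
  , subst (suc v ∈_) (sym (deleteComparator-channels δ eδ)) (∈-map⁺ suc v∈δ′))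

deleteLayer : Layer (suc n) → Maybe (Layer n)
deleteLayer L = layer? (mapMaybe deleteComparator (comparatorsOf L))
  (mapMaybe-allPairs {R = ComparatorsDisjoint} {S = ComparatorsDisjoint} deleteComparator
    (λ {γ} {δ} → deleteComparator-disjoint {γ = γ} {δ}) (Layer.disjoint L))

deleteChannel : Network (suc n) → Network n
deleteChannel = mapMaybe deleteLayer

flatten-layer? : ∀ (cs : List (Comparator n)) d → maybe comparatorsOf [] (layer? cs d) ≡ cs
flatten-layer? []       _ = refl
flatten-layer? (_ ∷ _) _ = refl

flatten-mapMaybe : ∀ {a} {A : Set a} (f : A → Maybe (Layer n)) xs →
  flatten (mapMaybe f xs) ≡ concatMap (maybe comparatorsOf [] ∘ f) xs
flatten-mapMaybe f []       = refl
flatten-mapMaybe f (x ∷ xs) with f x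
... | nothing = flatten-mapMaybe f xs
... | just L  = cong (comparatorsOf L List.++_) (flatten-mapMaybe f xs)

-- A layer that disappears would have contributed the empty list, so dropping it does not change the
-- flat list.
flatten-deleteChannel : ∀ (C : Network (suc n)) →
  flatten (deleteChannel C) ≡ mapMaybe deleteComparator (flatten C)
flatten-deleteChannel C = trans (flatten-mapMaybe deleteLayer C) (deleted C)
  where
  deleted : ∀ C → concatMap (maybe comparatorsOf [] ∘ deleteLayer) C ≡
                  mapMaybe deleteComparator (flatten C)
  deleted []      = refl
  deleted (L ∷ C) = trans (cong₂ List._++_ (flatten-layer? _ _) (deleted C))
    (sym (mapMaybe-++ deleteComparator (comparatorsOf L) (flatten C)))

depth-deleteChannel : ∀ (C : Network (suc n)) → depth (deleteChannel C) ≤ depth C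
depth-deleteChannel = length-mapMaybe deleteLayer

runBits-delete : ∀ cs (v : Vec Bool n) →
  runBits cs (false ∷ v) ≡ false ∷ runBits (mapMaybe deleteComparator cs) v
runBits-delete []                                     v = refl
-- Here `false ∧ b` is `false` and `false ∨ b` is `b`, so the comparator only overwrites position
-- `j` with its own value.
runBits-delete (comparator zero    (suc j) _   ∷ cs) v =
  trans (runBits-delete cs _)
    (cong (λ w → false ∷ runBits (mapMaybe deleteComparator cs) w) (Vec.[]≔-lookup v j))
runBits-delete (comparator (suc i) (suc j) i<j ∷ cs) v = runBits-delete cs _

deleteChannel-sorts : ∀ (C : Network (suc n)) →
  SortsBits (flatten C) → SortsBits (flatten (deleteChannel C))
deleteChannel-sorts C sorts v =
  subst (λ cs → Linked Bool._≤_ (runBits cs v)) (sym (flatten-deleteChannel C))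
    (Linked.tail (subst (Linked Bool._≤_) (runBits-delete (flatten C) v) (sorts (false ∷ v))))

-- The network on 20 channels

infix 6 _⇅_

-- On numerals the implicit arguments evaluate to the unit type, so the bounds and the order of the
-- channels are verified by computation.
_⇅_ : ∀ i j {i<n : True (i ℕ.<? n)} {j<n : True (j ℕ.<? n)}
      {i<j : True (Fin.fromℕ< (toWitness i<n) Fin.<? Fin.fromℕ< (toWitness j<n))} → Comparator n
_⇅_ i j {i<j = i<j} = comparator _ _ (toWitness i<j)

disjoint? : ∀ (γ δ : Comparator n) → Dec (ComparatorsDisjoint γ δ)
disjoint? γ δ = Disjoint.disjoint? Fin._≟_ (Comparator.channels γ) (Comparator.channels δ)

mkLayer : (cs : List⁺ (Comparator n)) {_ : True (allPairs? disjoint? (List⁺.toList cs))} → Layer n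
mkLayer cs {d} = layer cs (toWitness d)

initialLayers : Network 20
initialLayers =
    mkLayer (0 ⇅ 12 ∷ 1 ⇅ 13 ∷ 2 ⇅ 14 ∷ 3 ⇅ 15 ∷ 4 ⇅ 16 ∷ 5 ⇅ 17 ∷ 6 ⇅ 18 ∷ 7 ⇅ 19 ∷ 8 ⇅ 10 ∷ 9 ⇅ 11 ∷ [])
  ∷ mkLayer (0 ⇅ 2 ∷ 1 ⇅ 3 ∷ 4 ⇅ 6 ∷ 5 ⇅ 7 ∷ 8 ⇅ 9 ∷ 10 ⇅ 11 ∷ 12 ⇅ 14 ∷ 13 ⇅ 15 ∷ 16 ⇅ 18 ∷ 17 ⇅ 19 ∷ [])
  ∷ mkLayer (0 ⇅ 1 ∷ 2 ⇅ 3 ∷ 4 ⇅ 5 ∷ 6 ⇅ 7 ∷ 12 ⇅ 13 ∷ 14 ⇅ 15 ∷ 16 ⇅ 17 ∷ 18 ⇅ 19 ∷ [])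
  ∷ []

finalLayers : Network 20
finalLayers =
    mkLayer (0 ⇅ 4 ∷ 1 ⇅ 12 ∷ 2 ⇅ 16 ∷ 3 ⇅ 17 ∷ 5 ⇅ 8 ∷ 6 ⇅ 9 ∷ 7 ⇅ 18 ∷ 10 ⇅ 13 ∷ 11 ⇅ 14 ∷ 15 ⇅ 19 ∷ [])
  ∷ mkLayer (1 ⇅ 6 ∷ 3 ⇅ 10 ∷ 4 ⇅ 5 ∷ 7 ⇅ 11 ∷ 8 ⇅ 12 ∷ 9 ⇅ 16 ∷ 13 ⇅ 18 ∷ 14 ⇅ 15 ∷ [])
  ∷ mkLayer (0 ⇅ 4 ∷ 2 ⇅ 8 ∷ 3 ⇅ 9 ∷ 6 ⇅ 7 ∷ 10 ⇅ 16 ∷ 11 ⇅ 17 ∷ 12 ⇅ 13 ∷ 15 ⇅ 19 ∷ [])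
  ∷ mkLayer (1 ⇅ 4 ∷ 3 ⇅ 6 ∷ 5 ⇅ 8 ∷ 7 ⇅ 10 ∷ 9 ⇅ 12 ∷ 11 ⇅ 14 ∷ 13 ⇅ 16 ∷ 15 ⇅ 18 ∷ [])
  ∷ mkLayer (2 ⇅ 3 ∷ 4 ⇅ 5 ∷ 6 ⇅ 8 ∷ 7 ⇅ 9 ∷ 10 ⇅ 12 ∷ 11 ⇅ 13 ∷ 14 ⇅ 15 ∷ 16 ⇅ 17 ∷ [])
  ∷ mkLayer (2 ⇅ 4 ∷ 3 ⇅ 6 ∷ 5 ⇅ 7 ∷ 8 ⇅ 10 ∷ 9 ⇅ 11 ∷ 12 ⇅ 14 ∷ 13 ⇅ 16 ∷ 15 ⇅ 17 ∷ [])
  ∷ mkLayer (1 ⇅ 2 ∷ 3 ⇅ 5 ∷ 6 ⇅ 7 ∷ 8 ⇅ 9 ∷ 10 ⇅ 11 ∷ 12 ⇅ 13 ∷ 14 ⇅ 16 ∷ 17 ⇅ 18 ∷ [])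
  ∷ mkLayer (3 ⇅ 4 ∷ 5 ⇅ 6 ∷ 7 ⇅ 8 ∷ 9 ⇅ 10 ∷ 11 ⇅ 12 ∷ 13 ⇅ 14 ∷ 15 ⇅ 16 ∷ [])
  ∷ []

-- Splitting the first three layers into independent blocks.

-- With channels written in binary, the comparators run along the edges of the 3-cube, one dimension
-- after another. Sorting along one dimension preserves order along the others, so the outputs are
-- the monotone Boolean functions of three variables: 20 of them, a Dedekind number. In the same way
-- `block₄` yields the 6 monotone functions of two variables.
block₈ : List (Comparator 8)
block₈ = 0 ⇅ 4 ∷ 1 ⇅ 5 ∷ 2 ⇅ 6 ∷ 3 ⇅ 7 ∷ 0 ⇅ 2 ∷ 1 ⇅ 3 ∷ 4 ⇅ 6 ∷ 5 ⇅ 7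
       ∷ 0 ⇅ 1 ∷ 2 ⇅ 3 ∷ 4 ⇅ 5 ∷ 6 ⇅ 7 ∷ []

block₄ : List (Comparator 4)
block₄ = 0 ⇅ 2 ∷ 1 ⇅ 3 ∷ 0 ⇅ 1 ∷ 2 ⇅ 3 ∷ []

-- The blocks occupy channels 0–3 and 12–15, 4–7 and 16–19, and 8–11.
interleave : Vec Bool 8 → Vec Bool 8 → Vec Bool 4 → Vec Bool 20
interleave as bs cs =
  Vec.take 4 as Vec.++ Vec.take 4 bs Vec.++ cs Vec.++ Vec.drop 4 as Vec.++ Vec.drop 4 bs

interleave-surjective : ∀ v → ∃[ as ] ∃[ bs ] ∃[ cs ] v ≡ interleave as bs cs
interleave-surjective (a₀ ∷ a₁ ∷ a₂ ∷ a₃ ∷ b₀ ∷ b₁ ∷ b₂ ∷ b₃ ∷ c₀ ∷ c₁ ∷ c₂ ∷ c₃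
                       ∷ a₄ ∷ a₅ ∷ a₆ ∷ a₇ ∷ b₄ ∷ b₅ ∷ b₆ ∷ b₇ ∷ []) =
  (a₀ ∷ a₁ ∷ a₂ ∷ a₃ ∷ a₄ ∷ a₅ ∷ a₆ ∷ a₇ ∷ []) ,
  (b₀ ∷ b₁ ∷ b₂ ∷ b₃ ∷ b₄ ∷ b₅ ∷ b₆ ∷ b₇ ∷ []) ,
  (c₀ ∷ c₁ ∷ c₂ ∷ c₃ ∷ []) , refl

-- Once the vectors are split into variable bits, both sides compute to the same `∧`/`∨` formulas;
-- no case distinction on bits is made.
runBits-interleave : ∀ as bs cs → runBits (flatten initialLayers) (interleave as bs cs) ≡
  interleave (runBits block₈ as) (runBits block₈ bs) (runBits block₄ cs)
runBits-interleave (_ ∷ _ ∷ _ ∷ _ ∷ _ ∷ _ ∷ _ ∷ _ ∷ []) (_ ∷ _ ∷ _ ∷ _ ∷ _ ∷ _ ∷ _ ∷ _ ∷ [])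
                   (_ ∷ _ ∷ _ ∷ _ ∷ []) = refl

-- Exhaustive check over the reachable block outputs.

bitVectors : ∀ n → List (Vec Bool n)
bitVectors zero    = [] ∷ []
bitVectors (suc n) = List.map (false ∷_) (bitVectors n) List.++ List.map (true ∷_) (bitVectors n)

∈-bitVectors : ∀ (v : Vec Bool n) → v ∈ bitVectors n
∈-bitVectors []          = here refl
∈-bitVectors (false ∷ v) = ∈-++⁺ˡ (∈-map⁺ (false ∷_) (∈-bitVectors v))
∈-bitVectors (true  ∷ v) = ∈-++⁺ʳ _ (∈-map⁺ (true ∷_) (∈-bitVectors v))

-- Removing duplicates is what makes the check small: 256 inputs shrink to 20 outputs for `block₈`,
-- and 16 to 6 for `block₄`.
reachable : List (Comparator n) → List (Vec Bool n)
reachable cs = List.deduplicate (Vec.≡-dec Bool._≟_) (List.map (runBits cs) (bitVectors _))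

∈-reachable : ∀ (cs : List (Comparator n)) v → runBits cs v ∈ reachable cs
∈-reachable cs v = ∈-deduplicate⁺ (Vec.≡-dec Bool._≟_) (∈-map⁺ (runBits cs) (∈-bitVectors v))

SortsInterleavings : List (Comparator 20) → (Ra Rb : List (Vec Bool 8)) → List (Vec Bool 4) → Set
SortsInterleavings γs Ra Rb Rc =
  All (λ as → All (λ bs → All (λ cs → Linked Bool._≤_ (runBits γs (interleave as bs cs))) Rc) Rb) Ra

-- The lists are arguments so that evaluation computes each of them only once.
sortsInterleavings? : ∀ γs Ra Rb Rc → Dec (SortsInterleavings γs Ra Rb Rc)
sortsInterleavings? γs Ra Rb Rc =
  All.all? (λ as → All.all? (λ bs → All.all? (λ cs →
    linked? Bool._≤?_ (runBits γs (interleave as bs cs))) Rc) Rb) Ra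

-- Every input is an interleaving, and `C` turns it into an interleaving of reachable vectors, which
-- the finite table covers. With `C` and `D` as variables, their runs stay opaque in the proof.
sorts-by-blocks : ∀ (C D : Network 20) α β γ →
  (∀ as bs cs → runBits (flatten C) (interleave as bs cs) ≡
                interleave (runBits α as) (runBits β bs) (runBits γ cs)) →
  SortsInterleavings (flatten D) (reachable α) (reachable β) (reachable γ) →
  SortsBits (flatten (C List.++ D))
sorts-by-blocks C D α β γ splits sorts v with interleave-surjective v
... | as , bs , cs , refl = subst (Linked Bool._≤_)
  (sym (trans (runBits-flatten-++ C D _) (cong (runBits (flatten D)) (splits as bs cs))))
  (All.lookup (All.lookup (All.lookup sorts
    (∈-reachable α as)) (∈-reachable β bs)) (∈-reachable γ cs))

finalLayers-sort : SortsInterleavings (flatten finalLayers)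
  (reachable block₈) (reachable block₈) (reachable block₄)
-- The argument `_` has a type that reduces to the unit type once the decision procedure has
-- succeeded on all 20 · 20 · 6 triples; type checking performs this evaluation.
finalLayers-sort = toWitness {a? = sortsInterleavings? (flatten finalLayers)
  (reachable block₈) (reachable block₈) (reachable block₄)} _

-- Abstract, since comparing types that mention the network would otherwise lead
-- Agda to normalise its symbolic outputs.
abstract
  sorting₂₀ : ∃[ C ] SortsBits {20} (flatten C) × depth C ≡ 11
  sorting₂₀ = initialLayers List.++ finalLayers ,
    sorts-by-blocks initialLayers finalLayers block₈ block₈ block₄
      runBits-interleave finalLayers-sort ,
    refl

mainTheorem2 : (c ℓ₁ ℓ₂ : Level) →
    (∃[ C ] IsSortingNetwork c ℓ₁ ℓ₂ {20} C × depth C ≡ 11) ×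
    (∃[ C ] IsSortingNetwork c ℓ₁ ℓ₂ {19} C × depth C ≤ 11) ×
    (∀ (t₂₀ : ℕ) → IsMinimumDepth c ℓ₁ ℓ₂ 20 t₂₀ → t₂₀ ≤ 11) ×
    (∀ (t₁₉ : ℕ) → IsMinimumDepth c ℓ₁ ℓ₂ 19 t₁₉ → t₁₉ ≤ 11)
mainTheorem2 c ℓ₁ ℓ₂ =
  (network₂₀ , sorts₂₀ , depth₂₀≡11) ,
  (network₁₉ , sorts₁₉ , depth₁₉≤11) ,
  (λ t (_ , minimal) → subst (t ≤_) depth₂₀≡11 (minimal network₂₀ sorts₂₀)) ,
  (λ _ (_ , minimal) → ℕ.≤-trans (minimal network₁₉ sorts₁₉) depth₁₉≤11)
  where
  network₂₀ : Network 20
  network₂₀ = proj₁ sorting₂₀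

  sortsBits₂₀ : SortsBits (flatten network₂₀)
  sortsBits₂₀ = proj₁ (proj₂ sorting₂₀)

  depth₂₀≡11 : depth network₂₀ ≡ 11
  depth₂₀≡11 = proj₂ (proj₂ sorting₂₀)

  sorts₂₀ : IsSortingNetwork c ℓ₁ ℓ₂ network₂₀
  sorts₂₀ O = zero-one O network₂₀ sortsBits₂₀

  network₁₉ : Network 19
  network₁₉ = deleteChannel network₂₀

  sorts₁₉ : IsSortingNetwork c ℓ₁ ℓ₂ network₁₉
  sorts₁₉ O = zero-one O network₁₉ (deleteChannel-sorts network₂₀ sortsBits₂₀)

  depth₁₉≤11 : depth network₁₉ ≤ 11
  depth₁₉≤11 = subst (depth network₁₉ ≤_) depth₂₀≡11 (depth-deleteChannel network₂₀)
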